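{- Let $G=(V,E)$ be a graph with diameter $2$ and an even number $n\ge 90$ of vertices. For each integer $i\ge 0$ let $V_i=\{v\in V:\deg(v)=i\}$. If $G$ satisfies one of the following conditions: (1) $|\{i: |V_i| \text{ is odd}\}|>n/2$, or (2) $|V_i|$ is even for every $i$, then $h(G)=n/2$.
   Context: For a graph $G$ and $S\subseteq V(G)$, the distance multiset $D(S)$ is the multiset of shortest-path distances in $G$ between all unordered pairs of distinct vertices of $S$. Two vertex sets $S_1,S_2$ are homometric if $D(S_1)=D(S_2)$. $h(G)$ is the largest integer $h$ such that $G$ contains two disjoint homometric sets $S_1,S_2$ with $|S_1|=|S_2|=h$. -}

module Defs where

open import Data.Bool using (Bool; true; false; _∧_; _∨_; T; if_then_else_)
open import Data.Nat using (ℕ; zero; suc; _≡ᵇ_; _%_; _<_; _≤_)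
open import Data.Fin using (Fin; toℕ)
open import Data.List using (List; []; _∷_; map; _++_; length; filterᵇ; allFin; upTo)
open import Data.Bool.ListAction using (any)
open import Data.List.Relation.Unary.Unique.Propositional using (Unique)
open import Data.List.Relation.Binary.Permutation.Propositional using (_↭_)
open import Data.List.Membership.Propositional using (_∈_; _∉_)
open import Data.Product using (_×_; _,_; ∃; ∃-syntax; uncurry)
open import Relation.Binary.PropositionalEquality using (_≡_)

record Graph (n : ℕ) : Set where
  field
    adj    : Fin n → Fin n → Bool
    sym    : ∀ u v → adj u v ≡ adj v u
    irrefl : ∀ v → adj v v ≡ false
open Graph public

module _ {n : ℕ} (G : Graph n) where

  reach : ℕ → Fin n → Fin n → Bool
  reach zero    u v = toℕ u ≡ᵇ toℕ v
  reach (suc k) u v = reach k u v ∨ any (λ w → reach k u w ∧ adj G w v) (allFin n)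

  -- least k ≥ start, k < start + fuel, with reach k u v; if none, returns n
  -- (n is never a genuine distance in a graph on n vertices: it encodes "unreachable")
  private
    search : ℕ → ℕ → Fin n → Fin n → ℕ
    search zero       k u v = n
    search (suc fuel) k u v = if reach k u v then k else search fuel (suc k) u v

  dist : Fin n → Fin n → ℕ
  dist u v = search n 0 u v

  HasDiameter2 : Set
  HasDiameter2 = (∀ u v → dist u v ≤ 2) × ∃[ u ] ∃[ v ] (dist u v ≡ 2)

  degree : Fin n → ℕ
  degree v = length (filterᵇ (adj G v) (allFin n))

  degClassSize : ℕ → ℕ
  degClassSize i = length (filterᵇ (λ v → degree v ≡ᵇ i) (allFin n))

  -- |{ i : |V_i| odd }|  (only i < n can have V_i nonempty)
  numOddClasses : ℕ
  numOddClasses = length (filterᵇ (λ i → degClassSize i % 2 ≡ᵇ 1) (upTo n))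

  AllClassesEven : Set
  AllClassesEven = ∀ i → degClassSize i % 2 ≡ 0

pairs : {A : Set} → List A → List (A × A)
pairs []       = []
pairs (x ∷ xs) = map (x ,_) xs ++ pairs xs

module _ {n : ℕ} (G : Graph n) where

  -- distance multiset D(S), S given as a duplicate-free list of vertices
  D : List (Fin n) → List ℕ
  D S = map (uncurry (dist G)) (pairs S)

  HomometricPairOfSize : ℕ → Set
  HomometricPairOfSize h =
    ∃[ S₁ ] ∃[ S₂ ] (Unique S₁ × Unique S₂ × length S₁ ≡ h × length S₂ ≡ h
      × (∀ x → x ∈ S₁ → x ∉ S₂) × D S₁ ↭ D S₂)

  hEquals : ℕ → Set
  hEquals h = HomometricPairOfSize h × (∀ k → HomometricPairOfSize k → k ≤ h)

{-# OPTIONS --safe #-}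

-- In a graph of diameter 2 the distance multiset of S is determined by |S| and by the number e(S) of
-- edges inside S, and the degrees over S add up to 2 e(S) plus the number of edges leaving S.  So two
-- halves of the vertex set are homometric as soon as they have equal degree sums.  Vertices of equal
-- degree are put on opposite sides in pairs, which leaves one vertex for each odd class: 2t distinct
-- degrees in [1, 4t - 3] with an even sum, to be split into equally many with equal sums.
--
-- Pair the remaining degrees consecutively, put the two elements of each pair on opposite sides and
-- sign the differences greedily, the largest first.  This succeeds if some difference is 1 and no
-- difference exceeds the sum of the others.  If no difference is 1, the density forces two consecutive
-- pairs to be adjacent integers, and exchanging partners there produces a 1.  If one difference g
-- exceeds the sum of the others, the degrees on either side of that gap are so dense that exchanging
-- the partners of two pairs at a suitable distance produces differences that compensate g.
module Submission where

open import Defs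
open import Data.Bool using (Bool; true; false; not; if_then_else_; T; _∧_; _∨_)
open import Data.Bool.ListAction using (any)
open import Data.Bool.Properties using (T-∨; T-∧; T-≡; T?)
open import Data.Empty using (⊥-elim)
open import Data.Fin as Fin using (Fin; toℕ)
open import Data.Fin.Properties using (toℕ-injective; injective⇒≤)
open import Data.List using (List; []; _∷_; map; _++_; length; filterᵇ; allFin; upTo; replicate; lookup)
open import Data.List.Membership.Propositional using (_∈_; _∉_; find; lose)
open import Data.List.Membership.Propositional.Properties using (∈-∃++; ∈-++⁺ʳ; ∈-allFin; ∈-filter⁺; ∈-lookup; ∈-upTo⁺)
open import Data.List.Properties
  using (length-++; length-map; length-tabulate; map-++; map-cong; map-cong-local; map-∘; ++-assoc; ∷-injective; filter-none; filter-notAll)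
open import Data.List.Relation.Binary.Permutation.Propositional
  using (_↭_; prep; swap; ↭-refl; ↭-sym; ↭-trans; ↭-reflexive; ↭⇒↭ₛ; module PermutationReasoning)
open import Data.List.Relation.Binary.Permutation.Propositional.Properties
  using (shift; ++-comm; ++⁺; ++⁺ˡ; ++⁺ʳ; map⁺; All-resp-↭; ↭-length; ↭-map-inv)
import Data.List.Relation.Binary.Permutation.Setoid.Properties as Permutationₛ
open import Data.List.Relation.Unary.All as All using (All; []; _∷_)
import Data.List.Relation.Unary.All.Properties as All
open import Data.List.Relation.Unary.AllPairs as AllPairs using (AllPairs; []; _∷_)
import Data.List.Relation.Unary.AllPairs.Properties as AllPairs
open import Data.List.Relation.Unary.Any as Any using (Any; here; there; any?)
open import Data.List.Relation.Unary.Any.Properties using (any⁺; any⁻)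
open import Data.List.Relation.Unary.Linked.Properties using (Linked⇒AllPairs)
open import Data.List.Relation.Unary.Unique.Propositional using (Unique)
import Data.List.Relation.Unary.Unique.Propositional.Properties as Unique
import Data.List.Sort as Sort
open import Data.Nat using (ℕ; zero; suc; _+_; _*_; _≤_; _<_; z≤n; s≤s; s≤s⁻¹; _≡ᵇ_; _%_; _≟_; _≤?_)
open import Data.Nat.Divisibility using (_∣_; divides; ∣m+n∣m⇒∣n; ∣m∣n⇒∣m+n; m∣m*n)
open import Data.Nat.ListAction using (sum)
open import Data.Nat.ListAction.Properties using (sum-++; sum-↭)
open import Data.Nat.Properties
open import Data.Nat.Tactic.RingSolver using (solve-∀)
open import Data.Product using (∃-syntax; _×_; _,_; proj₁; proj₂; uncurry)
open import Data.Sum using (_⊎_; inj₁; inj₂)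
open import Function using (_∘_; id; Equivalence)
import Relation.Binary.Construct.Flip.EqAndOrd as Flip
import Relation.Binary.Construct.On as On
open import Relation.Binary.PropositionalEquality renaming (sym to ≡-sym)
open import Relation.Nullary using (¬_; yes; no)
open Equivalence using (to; from)

-- Splitting a list of numbers into two sublists of equal lengths and prescribed sum difference

-- Linear arithmetic by certificate: l ≤ r is a sum of hypotheses, s the slack, and the ring solver
-- checks the identity.
linear : ∀ {l r} → l ≤ r → ∀ {a b} s → a + r + s ≡ b + l → a ≤ b
linear {l} {r} l≤r {a} {b} s eq = +-cancelʳ-≤ r a b
  (≤-trans (m≤m+n (a + r) s) (≤-trans (≤-reflexive eq) (+-monoʳ-≤ b l≤r)))

infixl 6 _⊕_
_⊕_ : ∀ {a b c d} → a ≤ b → c ≤ d → a + c ≤ b + d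
_⊕_ = +-mono-≤

-- Only the integer `α - β` matters; two natural offsets replace signed arithmetic, and elements
-- already placed on either side can be moved into them.
Splits : List ℕ → ℕ → ℕ → Set
Splits xs α β = ∃[ ys ] ∃[ zs ] (xs ↭ ys ++ zs × length ys ≡ length zs × sum ys + α ≡ sum zs + β)

splits-↭ : ∀ {xs xs′ α β} → xs ↭ xs′ → Splits xs α β → Splits xs′ α β
splits-↭ p (ys , zs , q , eqs) = ys , zs , ↭-trans (↭-sym p) q , eqs

splits-flip : ∀ {xs α β} → Splits xs α β → Splits xs β α
splits-flip (ys , zs , p , l , s) = zs , ys , ↭-trans p (++-comm ys zs) , ≡-sym l , ≡-sym s

splits-[] : Splits [] 0 0
splits-[] = [] , [] , ↭-refl , refl , refl

splits-∷∷ : ∀ {xs α β} a b → Splits xs (α + a) (β + b) → Splits (a ∷ b ∷ xs) α β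
splits-∷∷ {α = α} {β} a b (ys , zs , p , l , s) = a ∷ ys , b ∷ zs ,
  prep a (↭-trans (prep b p) (↭-sym (shift b ys zs))) , cong suc l ,
  trans (rearrange a (sum ys) α) (trans s (≡-sym (rearrange b (sum zs) β)))
  where
  rearrange : ∀ x y z → (x + y) + z ≡ y + (z + x)
  rearrange = solve-∀

splits-shift : ∀ {xs α β α′ β′} → α + β′ ≡ α′ + β → Splits xs α β → Splits xs α′ β′
splits-shift {α = α} {β} {α′} {β′} eq (ys , zs , p , l , s) = ys , zs , p , l ,
  +-cancelʳ-≡ (α + β) _ _ (begin
    (sum ys + α′) + (α + β)  ≡⟨ regroup (sum ys) α′ α β ⟩
    (sum ys + α) + (α′ + β)  ≡⟨ cong₂ _+_ s (≡-sym eq) ⟩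
    (sum zs + β) + (α + β′)  ≡⟨ regroup′ (sum zs) β α β′ ⟩
    (sum zs + β′) + (α + β)  ∎)
  where
  open ≡-Reasoning
  regroup : ∀ x y z w → (x + y) + (z + w) ≡ (x + z) + (y + w)
  regroup = solve-∀
  regroup′ : ∀ x y z w → (x + y) + (z + w) ≡ (x + w) + (z + y)
  regroup′ = solve-∀

splits-++ : ∀ {xs xs′} → Splits xs 0 0 → Splits xs′ 0 0 → Splits (xs ++ xs′) 0 0
splits-++ {xs} {xs′} (ys , zs , p , l , s) (ys′ , zs′ , p′ , l′ , s′) = ys ++ ys′ , zs ++ zs′ ,
  (begin
    xs ++ xs′                 ↭⟨ ++⁺ p p′ ⟩
    (ys ++ zs) ++ ys′ ++ zs′  ≡⟨ ++-assoc ys zs _ ⟩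
    ys ++ zs ++ ys′ ++ zs′    ≡⟨ cong (ys ++_) (++-assoc zs ys′ zs′) ⟨
    ys ++ (zs ++ ys′) ++ zs′  ↭⟨ ++⁺ˡ ys (++⁺ʳ zs′ (++-comm zs ys′)) ⟩
    ys ++ (ys′ ++ zs) ++ zs′  ≡⟨ cong (ys ++_) (++-assoc ys′ zs zs′) ⟩
    ys ++ ys′ ++ zs ++ zs′    ≡⟨ ++-assoc ys ys′ _ ⟨
    (ys ++ ys′) ++ zs ++ zs′  ∎) ,
  trans (length-++ ys) (trans (cong₂ _+_ l l′) (≡-sym (length-++ zs))) ,
  cong (_+ 0) (trans (sum-++ ys ys′) (trans (cong₂ _+_ s₀ s₀′) (≡-sym (sum-++ zs zs′))))
  where
  open PermutationReasoning
  s₀ = trans (≡-sym (+-identityʳ (sum ys))) (trans s (+-identityʳ (sum zs)))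
  s₀′ = trans (≡-sym (+-identityʳ (sum ys′))) (trans s′ (+-identityʳ (sum zs′)))

-- a ▹ d stands for the two elements a and a + d.
infix 6 _▹_
record Pair : Set where
  constructor _▹_
  field low width : ℕ
open Pair

elems : List Pair → List ℕ
elems []            = []
elems (a ▹ d ∷ ps) = a ∷ a + d ∷ elems ps

widths : List Pair → ℕ
widths ps = sum (map width ps)

elems-↭ : ∀ {ps qs} → ps ↭ qs → elems ps ↭ elems qs
elems-↭ _↭_.refl = ↭-refl
elems-↭ (prep _ p) = prep _ (prep _ (elems-↭ p))
elems-↭ (swap (a ▹ d) (b ▹ e) p) =
  ↭-trans (++-comm (a ∷ a + d ∷ []) (b ∷ b + e ∷ _))
    (prep _ (prep _ (↭-trans (++-comm _ (a ∷ a + d ∷ [])) (prep _ (prep _ (elems-↭ p))))))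
elems-↭ (_↭_.trans p q) = ↭-trans (elems-↭ p) (elems-↭ q)

widths-↭ : ∀ {ps qs} → ps ↭ qs → widths ps ≡ widths qs
widths-↭ = sum-↭ ∘ map⁺ width

widths-++ : ∀ ps qs → widths (ps ++ qs) ≡ widths ps + widths qs
widths-++ ps qs = trans (cong sum (map-++ width ps qs)) (sum-++ (map width ps) (map width qs))

widths-≥ : ∀ {k ps} → All (λ p → k ≤ width p) ps → length ps * k ≤ widths ps
widths-≥ []       = z≤n
widths-≥ (h ∷ hs) = +-mono-≤ h (widths-≥ hs)

2∣+ : ∀ n → 2 ∣ n + n
2∣+ n = divides n (rearrange n)
  where
  rearrange : ∀ n → n + n ≡ n * 2
  rearrange = solve-∀

2∣cancel : ∀ k {m n} → k + k + n ≡ m → 2 ∣ m → 2 ∣ n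
2∣cancel k refl 2∣m = ∣m+n∣m⇒∣n 2∣m (2∣+ k)

2∣extend : ∀ k {m n} → m ≡ k + k + n → 2 ∣ n → 2 ∣ m
2∣extend k refl 2∣n = ∣m∣n⇒∣m+n (2∣+ k) 2∣n

sum-elems : ∀ ps → ∃[ k ] k + k + widths ps ≡ sum (elems ps)
sum-elems [] = 0 , refl
sum-elems (a ▹ d ∷ ps) with k , eq ← sum-elems ps =
  a + k , trans (rearrange a k d (widths ps)) (cong (λ s → a + (a + d + s)) eq)
  where
  rearrange : ∀ a k d w → (a + k) + (a + k) + (d + w) ≡ a + (a + d + (k + k + w))
  rearrange = solve-∀

2∣widths : ∀ ps → 2 ∣ sum (elems ps) → 2 ∣ widths ps
2∣widths ps even with k , eq ← sum-elems ps = 2∣cancel k eq even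

-- Greedy signing of the differences

data Complete : List Pair → Set where
  []  : Complete []
  _∷_ : ∀ {p ps} → width p ≤ suc (widths ps) → Complete ps → Complete (p ∷ ps)

-- `Complete` is Brown's criterion, read from the end of the list. The first difference `d` is
-- signed against the target, leaving `T - d` or, with the sides exchanged, `d - T`. Either is at
-- most one more than the remaining sum, by the bound on `T` or by `Complete`. Parity excludes the
-- target 1 at the end.
complete⇒splits : ∀ {ps} → Complete ps → ∀ T → T ≤ suc (widths ps) → 2 ∣ widths ps + T →
  Splits (elems ps) T 0
complete⇒splits [] 0 _ _ = splits-[]
complete⇒splits [] 1 _ (divides 0 ())
complete⇒splits [] 1 _ (divides (suc _) ())
complete⇒splits [] (suc (suc _)) (s≤s ())
complete⇒splits {a ▹ d ∷ ps} (d≤ ∷ c) T T≤ even with ≤-total d T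
... | inj₁ d≤T with T′ , refl ← m≤n⇒∃[o]m+o≡n d≤T =
  splits-∷∷ a (a + d) (splits-shift (eq T′ a d) (complete⇒splits c T′
    (linear T≤ 0 (bound T′ d (widths ps))) (2∣cancel d (parity T′ d (widths ps)) even)))
  where
  eq : ∀ T′ a d → T′ + (0 + (a + d)) ≡ ((d + T′) + a) + 0
  eq = solve-∀
  bound : ∀ T′ d w → T′ + suc (d + w) + 0 ≡ suc w + (d + T′)
  bound = solve-∀
  parity : ∀ T′ d w → d + d + (w + T′) ≡ (d + w) + (d + T′)
  parity = solve-∀
... | inj₂ T≤d with T′ , refl ← m≤n⇒∃[o]m+o≡n T≤d =
  splits-∷∷ a (a + (T + T′)) (splits-shift (eq T T′ a) (splits-flip (complete⇒splits c T′
    (linear d≤ T (bound T T′ (widths ps))) (2∣cancel T (parity T T′ (widths ps)) even))))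
  where
  eq : ∀ T T′ a → 0 + (0 + (a + (T + T′))) ≡ (T + a) + T′
  eq = solve-∀
  bound : ∀ T T′ w → T′ + suc w + T ≡ suc w + (T + T′)
  bound = solve-∀
  parity : ∀ T T′ w → T + T + (w + T′) ≡ ((T + T′) + w) + T
  parity = solve-∀

module Descending = Sort (Flip.decTotalOrder (On.decTotalOrder ≤-decTotalOrder width))

complete-++ : ∀ ps {qs} → Complete qs →
  (∀ pre p suf → ps ≡ pre ++ p ∷ suf → width p ≤ suc (widths suf + widths qs)) → Complete (ps ++ qs)
complete-++ []       c _ = c
complete-++ (p ∷ ps) c h =
  subst (λ w → width p ≤ suc w) (≡-sym (widths-++ ps _)) (h [] p ps refl) ∷
  complete-++ ps c (λ pre q suf eq → h (p ∷ pre) q suf (cong (p ∷_) eq))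

AllPairs-split : ∀ {A : Set} {R : A → A → Set} pre {x : A} {suf} → AllPairs R (pre ++ x ∷ suf) →
  All (λ y → R y x) pre × All (R x) suf
AllPairs-split []        (h ∷ _) = [] , h
AllPairs-split (y ∷ pre) (h ∷ hs) with below , above ← AllPairs-split pre hs =
  All.head (All.++⁻ʳ pre h) ∷ below , above

-- Greedy signing: with the differences in descending order, each of them is cancelled by the
-- smaller ones, and the pair of difference 1 takes care of the smallest.
greedy : ∀ a ps →
  (∀ pre p suf → ps ↭ pre ++ p ∷ suf → All (λ q → width p ≤ width q) pre → width p ≤ 2 + widths suf) →
  ∀ T → T ≤ 2 + widths ps → 2 ∣ suc (widths ps) + T → Splits (elems (a ▹ 1 ∷ ps)) T 0
greedy a ps bound T T≤ even =
  splits-↭ (elems-↭ (↭-sym perm)) (complete⇒splits complete T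
    (subst (λ w → T ≤ suc w) (widths-↭ perm) T≤) (subst (λ w → 2 ∣ w + T) (widths-↭ perm) even))
  where
  qs = Descending.sort ps

  perm : a ▹ 1 ∷ ps ↭ qs ++ a ▹ 1 ∷ []
  perm = ↭-trans (prep _ (↭-sym (Descending.sort-↭ ps))) (++-comm (a ▹ 1 ∷ []) qs)

  sorted : AllPairs (λ p q → width q ≤ width p) qs
  sorted = Linked⇒AllPairs (λ p≥q q≥r → ≤-trans q≥r p≥q) (Descending.sort-↗ ps)

  -- The pair of difference 1 stands last and is part of every remaining sum. It accounts for one
  -- unit of `2 + widths suf`, the slack in `Complete` for the other.
  complete : Complete (qs ++ a ▹ 1 ∷ [])
  complete = complete-++ qs (≤-refl ∷ []) λ pre p suf eq →
    subst (width p ≤_) (cong suc (+-comm 1 (widths suf)))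
      (bound pre p suf (↭-trans (↭-sym (Descending.sort-↭ ps)) (↭-reflexive eq))
        (proj₁ (AllPairs-split pre (subst (AllPairs _) eq sorted))))

length-split : ∀ {ps : List Pair} pre {p suf} → ps ↭ pre ++ p ∷ suf → length ps ≡ length pre + suc (length suf)
length-split pre perm = trans (↭-length perm) (length-++ pre)

widths-split : ∀ {ps} pre {p suf} → ps ↭ pre ++ p ∷ suf → widths ps ≡ widths pre + (width p + widths suf)
widths-split pre perm = trans (widths-↭ perm) (widths-++ pre _)

Positive : List Pair → Set
Positive = All (λ p → 1 ≤ width p)

positive-suffix : ∀ {k ps} pre {p suf} → ps ↭ pre ++ p ∷ suf → All (λ q → k ≤ width q) ps → length suf * k ≤ widths suf
positive-suffix pre perm h with _ ∷ hs ← All.++⁻ʳ pre (All-resp-↭ perm h) = widths-≥ hs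

1≰0 : ¬ 1 ≤ 0
1≰0 ()

-- Falsity is phrased as `1 ≤ 0` so that certificates for `linear` also serve as refutations.
by-contradiction : ∀ {m n} → (suc n ≤ m → 1 ≤ 0) → m ≤ n
by-contradiction {m} {n} h with m ≤? n
... | yes m≤n = m≤n
... | no m≰n = ⊥-elim (1≰0 (h (≰⇒> m≰n)))

-- If a difference were at least `3 + S`, with `S` the sum of the `l` later ones, then the `q`
-- earlier ones would be at least 3 each. Since `S ≥ l`, the total would be at least `3q + 3 + 2l`,
-- more than 2 per pair.
dense-splits′ : ∀ a {ps} → Positive ps → widths ps ≤ 2 * length ps →
  ∀ T → T ≤ 2 + widths ps → 2 ∣ suc (widths ps) + T → Splits (elems (a ▹ 1 ∷ ps)) T 0
dense-splits′ a {ps} positive w≤ = greedy a ps λ pre p suf perm large → by-contradiction λ 3+S≤d →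
  let q = length pre; l = length suf; d = width p; S = widths suf
      l≤S = positive-suffix pre perm positive in
  linear
    (w≤ ⊕ ≤-reflexive (≡-sym (widths-split pre perm)) ⊕ widths-≥ large ⊕ *-monoʳ-≤ q (≤-trans (s≤s (s≤s (s≤s z≤n))) 3+S≤d)
      ⊕ ≤-reflexive (cong (2 *_) (length-split pre perm)) ⊕ 3+S≤d ⊕ l≤S ⊕ l≤S)
    q (arith (widths ps) (length ps) q l d S (widths pre) (q * d))
  where
  arith : ∀ W r q l d S P qd →
    1 + (2 * r + W + P + qd + 2 * (q + suc l) + d + S + S) + q ≡
    0 + (W + (P + (d + S)) + qd + q * 3 + 2 * r + (3 + S) + l * 1 + l * 1)
  arith = solve-∀

extract : ∀ {P : Pair → Set} {ps} → Any P ps → ∃[ p ] ∃[ qs ] (P p × ps ↭ p ∷ qs)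
extract (here {x = p} {xs} h)  = p , xs , h , ↭-refl
extract (there {x = q} h) with p , qs , h′ , perm ← extract h =
  p , q ∷ qs , h′ , ↭-trans (prep q perm) (swap q p ↭-refl)

unit-or-wide : ∀ ps → Positive ps → (∃[ a ] ∃[ qs ] ps ↭ a ▹ 1 ∷ qs) ⊎ All (λ p → 2 ≤ width p) ps
unit-or-wide ps positive with any? (λ p → width p ≟ 1) ps
... | yes h with a ▹ _ , qs , refl , perm ← extract h = inj₁ (a , qs , perm)
... | no ¬h = inj₂ (All.zipWith (λ (1≤d , d≢1) → ≤∧≢⇒< 1≤d (d≢1 ∘ ≡-sym)) (positive , All.¬Any⇒All¬ ps ¬h))

-- An average difference below 2 forces a difference 1, which is taken out for the greedy signing.
dense-splits : ∀ {ps} → Positive ps → widths ps < 2 * length ps →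
  ∀ T → T ≤ suc (widths ps) → 2 ∣ widths ps + T → Splits (elems ps) T 0
dense-splits {ps} positive w< T T≤ even with unit-or-wide ps positive
... | inj₂ wide = ⊥-elim (<⇒≱ w< (subst (_≤ widths ps) (*-comm (length ps) 2) (widths-≥ wide)))
... | inj₁ (a , qs , perm) = splits-↭ (elems-↭ (↭-sym perm)) (dense-splits′ a
  (All.tail (All-resp-↭ perm positive))
  (linear (subst₂ (λ w l → suc w ≤ 2 * l) (widths-↭ perm) (↭-length perm) w<) 0 (arith (widths qs) (length qs)))
  T (subst (λ w → T ≤ suc w) (widths-↭ perm) T≤) (subst (λ w → 2 ∣ w + T) (widths-↭ perm) even))
  where
  arith : ∀ w l → w + 2 * suc l + 0 ≡ 2 * l + suc (suc w)
  arith = solve-∀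

-- The hypothesis that no difference is dominant settles the first one in the sorted order. If a
-- later one were at least `3 + S`, so would be the one before it, and the total would be at least
-- `6 + 3q + 3S`, that is, 3 per pair.
moderate-splits : ∀ a {ps} → Positive ps → suc (widths ps) ≤ 3 * length ps →
  All (λ p → 2 * width p ≤ 2 + widths ps) ps → 2 ∣ suc (widths ps) → Splits (elems (a ▹ 1 ∷ ps)) 0 0
moderate-splits a {ps} positive w< moderate even =
  greedy a ps bound 0 z≤n (subst (2 ∣_) (≡-sym (+-identityʳ _)) even)
  where
  arith₀ : ∀ W d S → d + (2 + W + (d + S)) + 0 ≡ (2 + S) + (2 * d + W)
  arith₀ = solve-∀

  arith : ∀ W r q l d S P qd →
    1 + (3 * r + (W + P + qd) + 3 * (suc q + suc l) + (d + d + S + S + S)) + 0 ≡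
    0 + (suc W + ((P + (d + S)) + (d + qd) + q * 3) + 3 * r + ((3 + S) + (3 + S) + l * 1 + l * 1 + l * 1))
  arith = solve-∀

  bound : ∀ pre p suf → ps ↭ pre ++ p ∷ suf → All (λ q → width p ≤ width q) pre → width p ≤ 2 + widths suf
  bound [] p suf perm _ = linear
    (All.head (All-resp-↭ perm moderate) ⊕ ≤-reflexive (widths-split [] perm)) 0
    (arith₀ (widths ps) (width p) (widths suf))
  bound pre@(_ ∷ pre′) p suf perm large = by-contradiction λ 3+S≤d →
    let q = length pre′; l = length suf; d = width p; S = widths suf
        l≤S = positive-suffix pre perm positive in
    linear
      (w< ⊕ (≤-reflexive (≡-sym (widths-split pre perm)) ⊕ widths-≥ large
          ⊕ *-monoʳ-≤ q (≤-trans (s≤s (s≤s (s≤s z≤n))) 3+S≤d))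
        ⊕ ≤-reflexive (cong (3 *_) (length-split pre perm)) ⊕ (3+S≤d ⊕ 3+S≤d ⊕ l≤S ⊕ l≤S ⊕ l≤S)) 0
      (arith (widths ps) (length ps) q l d S (widths pre) (q * d))

wide-splits : ∀ a m {ps} → 5 ≤ width m → 2 ≤ length ps → All (λ p → 2 ≤ width p) ps →
  widths (m ∷ ps) ≤ 1 + 3 * length (m ∷ ps) → 2 ∣ suc (widths (m ∷ ps)) → Splits (elems (a ▹ 1 ∷ m ∷ ps)) 0 0
wide-splits a m {ps} 5≤m 2≤length wide w≤ even =
  greedy a (m ∷ ps) bound 0 z≤n (subst (2 ∣_) (≡-sym (+-identityʳ _)) even)
  where
  wide′ : All (λ p → 2 ≤ width p) (m ∷ ps)
  wide′ = ≤-trans (s≤s (s≤s z≤n)) 5≤m ∷ wide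

  arith₀ : ∀ m W r → 1 + (1 + 3 * suc r + m + W) + 0 ≡ 0 + (m + W + 5 + r * 3)
  arith₀ = solve-∀

  arith₁ : ∀ W r l d S →
    1 + (1 + 3 * suc r + W + 3 * suc (suc l) + (S + S) + d + (r + suc (suc l))) + 0 ≡
    0 + (W + (d + S) + 3 * suc r + (suc l * 2 + suc l * 2) + (3 + S) + (2 + suc r))
  arith₁ = solve-∀

  arith₂ : ∀ W r q l d S P qd →
    1 + (1 + 3 * suc r + (W + P + qd) + 3 * (suc q + suc (suc l)) + (d + d + S + S + S)) + suc (3 * l) ≡
    0 + (W + ((P + (d + S)) + (d + qd) + q * 3) + 3 * suc r + ((3 + S) + (3 + S) + suc l * 2 + suc l * 2 + suc l * 2))
  arith₂ = solve-∀

  bound : ∀ pre p suf → m ∷ ps ↭ pre ++ p ∷ suf → All (λ q → width p ≤ width q) pre → width p ≤ 2 + widths suf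
  -- The last, hence smallest, difference: were it at least 3, all would be, and the 5 of `m` would
  -- lift the total to `5 + 3 * length ps`, one too many.
  bound pre p [] perm large = by-contradiction λ 3≤d →
    linear (w≤ ⊕ 5≤m ⊕ widths-≥ (All.tail (All-resp-↭ (↭-sym perm)
        (All.map (≤-trans 3≤d) large′)))) 0 (arith₀ (width m) (widths ps) (length ps))
    where
    large′ : All (λ q → width p ≤ width q) (pre ++ p ∷ [])
    large′ = All.++⁺ large (≤-refl ∷ [])
  -- The first difference: as the later ones are at least 2, a violation makes the total at least
  -- `3 + 4 * length suf⁺`. This is within the bound only if one pair remains, which `2 ≤ length ps`
  -- excludes.
  bound [] p suf⁺@(_ ∷ suf) perm _ = by-contradiction λ 3+S≤d →
    let l≤S = positive-suffix [] perm wide′; r≤ = ≤-reflexive (length-split [] perm) in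
    linear
      (w≤ ⊕ ≤-reflexive (≡-sym (widths-split [] perm)) ⊕ *-monoʳ-≤ 3 r≤ ⊕ (l≤S ⊕ l≤S) ⊕ 3+S≤d ⊕ (2≤length ⊕ r≤)) 0
      (arith₁ (widths (m ∷ ps)) (length ps) (length suf) (width p) (widths suf⁺))
  bound pre@(_ ∷ pre′) p suf⁺@(_ ∷ suf) perm large = by-contradiction λ 3+S≤d →
    let q = length pre′; l = length suf; d = width p; S = widths suf⁺
        l≤S = positive-suffix pre perm wide′ in
    linear
      (w≤ ⊕ (≤-reflexive (≡-sym (widths-split pre perm)) ⊕ widths-≥ large
          ⊕ *-monoʳ-≤ q (≤-trans (s≤s (s≤s (s≤s z≤n))) 3+S≤d))
        ⊕ *-monoʳ-≤ 3 (≤-reflexive (length-split pre perm)) ⊕ (3+S≤d ⊕ 3+S≤d ⊕ l≤S ⊕ l≤S ⊕ l≤S)) (suc (3 * l))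
      (arith₂ (widths (m ∷ ps)) (length ps) q l d S (widths pre) (q * d))

-- Consecutive pairs of a dense increasing sequence

-- The elements of the pairs increase strictly and lie in the half-open interval [lo, hi).
data Chain : ℕ → List Pair → ℕ → Set where
  []   : ∀ {lo hi} → lo ≤ hi → Chain lo [] hi
  link : ∀ {lo hi a d ps} → lo ≤ a → 1 ≤ d → Chain (suc (a + d)) ps hi → Chain lo (a ▹ d ∷ ps) hi

chain-positive : ∀ {lo ps hi} → Chain lo ps hi → Positive ps
chain-positive ([] _)          = []
chain-positive (link _ 1≤d c) = 1≤d ∷ chain-positive c

chain-length : ∀ {lo ps hi} → Chain lo ps hi → lo + 2 * length ps ≤ hi
chain-length ([] lo≤hi) = ≤-trans (≤-reflexive (+-identityʳ _)) lo≤hi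
chain-length {lo} {a ▹ d ∷ ps} {hi} (link lo≤a 1≤d c) = linear (lo≤a ⊕ 1≤d ⊕ chain-length c) 0 (arith lo a d (length ps) hi)
  where
  arith : ∀ lo a d l hi → lo + 2 * suc l + (a + d + hi) + 0 ≡ hi + (lo + 1 + (suc (a + d) + 2 * l))
  arith = solve-∀

chain-widths : ∀ {lo ps hi} → Chain lo ps hi → lo + widths ps + length ps ≤ hi
chain-widths {lo} ([] lo≤hi) = ≤-trans (≤-reflexive (trans (+-identityʳ _) (+-identityʳ lo))) lo≤hi
chain-widths {lo} {a ▹ d ∷ ps} {hi} (link lo≤a _ c) = linear (lo≤a ⊕ chain-widths c) 0 (arith lo a d (widths ps) (length ps) hi)
  where
  arith : ∀ lo a d w l hi → lo + (d + w) + suc l + (a + hi) + 0 ≡ hi + (lo + (suc (a + d) + w + l))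
  arith = solve-∀

chain-++ : ∀ {lo hi} ps {qs} → Chain lo (ps ++ qs) hi → ∃[ mid ] (Chain lo ps mid × Chain mid qs hi)
chain-++ []       c = _ , [] ≤-refl , c
chain-++ (p ∷ ps) (link lo≤a 1≤d c) with mid , c₁ , c₂ ← chain-++ ps c = mid , link lo≤a 1≤d c₁ , c₂

Adjacent : List Pair → Set
Adjacent ps = ∃[ a ] ∃[ d ] ∃[ e ] ∃[ qs ] ps ↭ a ▹ d ∷ suc (a + d) ▹ e ∷ qs

-- A pair of difference at least 2 spans at least three integers, and without adjacency a fourth
-- separates it from the next pair. The last pair lacks this fourth integer, hence `suc hi`.
adjacent-or-long : ∀ {lo ps hi} → Chain lo ps hi → All (λ p → 2 ≤ width p) ps → Adjacent ps ⊎ lo + 4 * length ps ≤ suc hi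
adjacent-or-long {lo} ([] lo≤hi) [] = inj₂ (≤-trans (≤-reflexive (+-identityʳ lo)) (m≤n⇒m≤1+n lo≤hi))
adjacent-or-long {lo} {a ▹ d ∷ []} {hi} (link lo≤a _ ([] a+d<hi)) (2≤d ∷ []) = inj₂ (linear (lo≤a ⊕ 2≤d ⊕ a+d<hi) 0 (arith lo a d hi))
  where
  arith : ∀ lo a d hi → lo + 4 + (a + d + hi) + 0 ≡ suc hi + (lo + 2 + suc (a + d))
  arith = solve-∀
adjacent-or-long {lo} {a ▹ d ∷ b ▹ e ∷ ps} {hi} (link lo≤a _ (link a+d<b 1≤e c)) (2≤d ∷ wide) with suc (a + d) ≟ b
... | yes refl = inj₁ (a , d , e , ps , ↭-refl)
... | no ≢b with adjacent-or-long (link (≤∧≢⇒< a+d<b ≢b) 1≤e c) wide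
...   | inj₁ (a′ , d′ , e′ , qs , perm) = inj₁ (a′ , d′ , e′ , a ▹ d ∷ qs , ↭-trans (prep _ perm) (↭-sym (shift (a ▹ d) (_ ∷ _ ∷ []) qs)))
...   | inj₂ long = inj₂ (linear (lo≤a ⊕ 2≤d ⊕ long) 0 (arith lo a d (length ps) hi))
  where
  arith : ∀ lo a d l hi → lo + 4 * suc (suc l) + (a + d + suc hi) + 0 ≡ suc hi + (lo + 2 + (suc (suc (a + d)) + 4 * suc l))
  arith = solve-∀

-- If no pair has difference 1, consecutive pairs (a, b), (b + 1, c) are re-paired as (b, b + 1), (a, c).
adjacent-splits : ∀ {ps} → Adjacent ps → All (λ p → 2 ≤ width p) ps → 4 ≤ length ps →
  3 + widths ps ≤ 3 * length ps → 2 ∣ widths ps → Splits (elems ps) 0 0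
adjacent-splits {ps} (a , d , e , qs , perm) wide 4≤length w≤ even with 2≤d ∷ 2≤e ∷ wide′ ← All-resp-↭ perm wide =
  -- Since `d` and `e` are at least 2, the new outer pair has difference `d + 1 + e ≥ 5`. The sum of
  -- all differences grows by 2, so its parity is kept.
  splits-↭ repaired (wide-splits (a + d) (a ▹ (d + suc e)) (linear (2≤d ⊕ 2≤e) 0 (arith₁ d e))
    (s≤s⁻¹ (s≤s⁻¹ (subst (4 ≤_) (↭-length perm) 4≤length))) wide′
    (linear (subst₂ (λ w l → 3 + w ≤ 3 * l) (widths-↭ perm) (↭-length perm) w≤) 0 (arith₂ d e (widths qs) (length qs)))
    (2∣extend 1 (arith₃ d e (widths qs)) (subst (2 ∣_) (widths-↭ perm) even)))
  where
  arith₁ : ∀ d e → 5 + (d + e) + 0 ≡ d + suc e + (2 + 2)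
  arith₁ = solve-∀
  arith₂ : ∀ d e w l → d + suc e + w + 3 * suc (suc l) + 0 ≡ 1 + 3 * suc l + (3 + (d + (e + w)))
  arith₂ = solve-∀
  arith₃ : ∀ d e w → suc (d + suc e + w) ≡ 1 + 1 + (d + (e + w))
  arith₃ = solve-∀
  arith₄ : ∀ a d e → a + (d + suc e) ≡ suc (a + d) + e
  arith₄ = solve-∀

  repaired : elems ((a + d) ▹ 1 ∷ a ▹ (d + suc e) ∷ qs) ↭ elems ps
  repaired = ↭-trans (shift a (a + d ∷ a + d + 1 ∷ []) _)
    (↭-trans (↭-reflexive (cong₂ (λ y z → a ∷ a + d ∷ y ∷ z ∷ elems qs) (+-comm (a + d) 1) (arith₄ a d e)))
      (elems-↭ (↭-sym perm)))

re-paired-splits : ∀ x g a d w e f {qs} → w + e ≡ d + f → ∀ T →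
  g + T ≡ w + f ⊎ w + f + T ≡ g → Splits (elems qs) T 0 → Splits (elems (x ▹ g ∷ a ▹ d ∷ (a + w) ▹ e ∷ qs)) 0 0

-- Exchanging partners against a dominant difference

re-paired-splits x g a d w e f {qs} w+e≡d+f T difference s =
  -- The flip after the first pair puts `w` and `f` against `g`, so the other pairs have to make up
  -- for `T`, the distance between `g` and `w + f`.
  splits-↭ reorder (splits-∷∷ x (x + g) (splits-flip
    (splits-∷∷ a (a + w) (splits-∷∷ (a + d) (a + (d + f)) (balance difference)))))
  where
  balance : g + T ≡ w + f ⊎ w + f + T ≡ g →
    Splits (elems qs) (x + g + a + (a + d)) (x + (a + w) + (a + (d + f)))
  balance (inj₁ eq) = splits-shift
    (trans (left x a d w f) (trans (cong (x + a + a + d +_) (≡-sym eq)) (right x a d g T))) (splits-flip s)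
    where
    left : ∀ x a d w f → x + (a + w) + (a + (d + f)) ≡ x + a + a + d + (w + f)
    left = solve-∀
    right : ∀ x a d g T → x + a + a + d + (g + T) ≡ x + g + a + (a + d) + T
    right = solve-∀
  balance (inj₂ refl) = splits-shift (left T x a d w f) s
    where
    left : ∀ T x a d w f → T + (x + (a + w) + (a + (d + f))) ≡ x + (w + f + T) + a + (a + d) + 0
    left = solve-∀

  reorder : x ∷ x + g ∷ a ∷ a + w ∷ a + d ∷ a + (d + f) ∷ elems qs ↭ elems (x ▹ g ∷ a ▹ d ∷ (a + w) ▹ e ∷ qs)
  reorder = prep x (prep (x + g) (prep a (swap (a + w) (a + d)
    (↭-reflexive (cong (_∷ elems qs) (trans (cong (a +_) (≡-sym w+e≡d+f)) (≡-sym (+-assoc a w e))))))))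

module _ (g d w e f r δ : ℕ) (qs : List Pair) where
  private
    n = length qs
    S = widths qs
    t = 3 + n

  -- The pair of difference g outweighs all the other consecutive pairs.  Exchanging the upper
  -- elements of (a, a + d) and (a + w, a + w + e) turns d and e into w and f, which together are
  -- close enough to g for the remaining pairs to make up for the discrepancy.
  dominant-splits : ∀ x a → w + e ≡ d + f → Positive qs → 1 ≤ d → 1 ≤ e → 2 ≤ n →
    2 + (d + (e + S)) ≤ g → 3 + (g + (d + (e + S))) ≤ 3 * t →
    2 * r ≤ w → 2 * r ≤ f → w + g + 2 ≤ 2 * t + 2 * r → f + g + 2 ≤ 2 * t + 2 * r →
    g ≡ t + δ → δ + 2 ≤ 4 * r → 4 * r ≤ 3 * δ + 2 → 2 ∣ g + (d + (e + S)) →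
    Splits (elems (x ▹ g ∷ a ▹ d ∷ (a + w) ▹ e ∷ qs)) 0 0
  dominant-splits x a w+e≡d+f positive 1≤d 1≤e 2≤n dominant total r≤w r≤f w≤ f≤ g≡ δ≤ ≤δ even = go (≤-total g (w + f))
    where
    n≤S : n * 1 ≤ S
    n≤S = widths-≥ positive

    -- Dominance leaves less than half of the total to the other differences, so `2 * S ≤ 3 * n`;
    -- with `2 ≤ n` this gives `S < 2 * n`.
    dense : S < 2 * n
    dense = *-cancelˡ-≤ 2 (linear (dominant ⊕ total ⊕ 1≤d ⊕ 1≤d ⊕ 1≤e ⊕ 1≤e ⊕ 2≤n) 0 (arith g d e S n))
      where
      arith : ∀ g d e S n → 2 * suc S + (g + 3 * (3 + n) + d + d + e + e + n) + 0 ≡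
        2 * (2 * n) + (2 + (d + (e + S)) + (3 + (g + (d + (e + S)))) + 1 + 1 + 1 + 1 + 2)
      arith = solve-∀

    finish : ∀ T → g + T ≡ w + f ⊎ w + f + T ≡ g → T ≤ suc S → 2 ∣ S + T →
      Splits (elems (x ▹ g ∷ a ▹ d ∷ (a + w) ▹ e ∷ qs)) 0 0
    finish T eq T≤ evenT = re-paired-splits x g a d w e f w+e≡d+f T eq (dense-splits positive dense T T≤ evenT)

    -- In both cases `T ≤ t - 2 = n + 1 ≤ suc S`. If `g ≤ w + f`, the upper bounds on `w` and `f`
    -- give `T ≤ t + 4r - 3δ - 4`, and `4r ≤ 3δ + 2` applies. Otherwise the lower bounds give
    -- `T ≤ t + δ - 4r`, and `δ + 2 ≤ 4r` applies.
    go : g ≤ w + f ⊎ w + f ≤ g → Splits (elems (x ▹ g ∷ a ▹ d ∷ (a + w) ▹ e ∷ qs)) 0 0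
    go (inj₁ g≤w+f) with T , eq ← m≤n⇒∃[o]m+o≡n g≤w+f = finish T (inj₁ eq)
      (linear (w≤ ⊕ f≤ ⊕ ≤-reflexive eq ⊕ ≤δ ⊕ n≤S ⊕ *-monoʳ-≤ 3 (≤-reflexive (≡-sym g≡))) 0 (bound T g w f r δ n S))
      (2∣cancel (g + d) parity (2∣extend w refl even))
      where
      open ≡-Reasoning
      bound : ∀ T g w f r δ n S →
        T + (2 * (3 + n) + 2 * r + (2 * (3 + n) + 2 * r) + (w + f) + (3 * δ + 2) + S + 3 * g) + 0 ≡
        suc S + (w + g + 2 + (f + g + 2) + (g + T) + 4 * r + n * 1 + 3 * (3 + n + δ))
      bound = solve-∀
      left : ∀ g d S T → (g + d) + (g + d) + (S + T) ≡ (g + T) + (d + d + g + S)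
      left = solve-∀
      middle : ∀ g d S w f → (w + f) + (d + d + g + S) ≡ (d + f) + (w + d + g + S)
      middle = solve-∀
      right : ∀ g d S w e → (w + e) + (w + d + g + S) ≡ w + w + (g + (d + (e + S)))
      right = solve-∀
      parity : (g + d) + (g + d) + (S + T) ≡ w + w + (g + (d + (e + S)))
      parity = begin
        (g + d) + (g + d) + (S + T)    ≡⟨ left g d S T ⟩
        (g + T) + (d + d + g + S)      ≡⟨ cong (_+ (d + d + g + S)) eq ⟩
        (w + f) + (d + d + g + S)      ≡⟨ middle g d S w f ⟩
        (d + f) + (w + d + g + S)      ≡⟨ cong (_+ (w + d + g + S)) w+e≡d+f ⟨
        (w + e) + (w + d + g + S)      ≡⟨ right g d S w e ⟩
        w + w + (g + (d + (e + S)))    ∎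
    go (inj₂ w+f≤g) with T , eq ← m≤n⇒∃[o]m+o≡n w+f≤g = finish T (inj₂ eq)
      (linear (≤-reflexive eq ⊕ ≤-reflexive g≡ ⊕ r≤w ⊕ r≤f ⊕ δ≤ ⊕ n≤S) 0 (bound T g w f r δ n S))
      (2∣cancel (w + f + d) parity (2∣extend w refl even))
      where
      open ≡-Reasoning
      bound : ∀ T g w f r δ n S →
        T + (g + (3 + n + δ) + w + f + 4 * r + S) + 0 ≡ suc S + (w + f + T + g + 2 * r + 2 * r + (δ + 2) + n * 1)
      bound = solve-∀
      left : ∀ d S T w f → (w + f + d) + (w + f + d) + (S + T) ≡ (w + f + T) + ((d + f) + (w + d + S))
      left = solve-∀
      right : ∀ g d S w e → g + ((w + e) + (w + d + S)) ≡ w + w + (g + (d + (e + S)))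
      right = solve-∀
      parity : (w + f + d) + (w + f + d) + (S + T) ≡ w + w + (g + (d + (e + S)))
      parity = begin
        (w + f + d) + (w + f + d) + (S + T)        ≡⟨ left d S T w f ⟩
        (w + f + T) + ((d + f) + (w + d + S))      ≡⟨ cong₂ (λ y z → y + (z + (w + d + S))) eq (≡-sym w+e≡d+f) ⟩
        g + ((w + e) + (w + d + S))                ≡⟨ right g d S w e ⟩
        w + w + (g + (d + (e + S)))                ∎

chain-drop : ∀ r {lo ps hi} → Chain lo ps hi → r < length ps →
  ∃[ c ] ∃[ e ] ∃[ qs ] ∃[ k ] (ps ↭ c ▹ e ∷ qs × length ps ≡ r + suc k × lo + 2 * r ≤ c × suc (c + e) + 2 * k ≤ hi)
chain-drop _ ([] _) ()
chain-drop zero {lo} {c ▹ e ∷ qs} (link lo≤c _ chain) _ =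
  c , e , qs , length qs , ↭-refl , refl , ≤-trans (≤-reflexive (+-identityʳ lo)) lo≤c , chain-length chain
chain-drop (suc r) {lo} {a ▹ d ∷ ps} (link lo≤a 1≤d chain) (s≤s r<)
  with c , e , qs , k , perm , eq , ≤c , c≤ ← chain-drop r chain r< =
  c , e , a ▹ d ∷ qs , k , ↭-trans (prep _ perm) (swap _ _ ↭-refl) , cong suc eq ,
  linear (lo≤a ⊕ 1≤d ⊕ ≤c) 0 (arith lo a d c r) , c≤
  where
  arith : ∀ lo a d c r → lo + 2 * suc r + (a + d + c) + 0 ≡ c + (lo + 1 + (suc (a + d) + 2 * r))
  arith = solve-∀

-- For δ = g − t, the two pairs that exchange partners are 1 + r places apart.
quarter : ∀ δ → 1 ≤ δ → ∃[ r ] (δ + 2 ≤ 4 * suc r × 4 * suc r ≤ 3 * δ + 2 × 4 * suc r ≤ δ + 5)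
-- `4 * suc r` is the multiple of 4 among the four consecutive integers from `δ + 2` to `δ + 5`.
-- Only for `δ = 1` is `3 * δ + 2` below `δ + 5`, and there the multiple is 4.
quarter 1 _ = 0 , m≤m+n 3 1 , m≤m+n 4 1 , m≤m+n 4 2
quarter 2 _ = 0 , m≤m+n 4 0 , m≤m+n 4 4 , m≤m+n 4 3
quarter 3 _ = 1 , m≤m+n 5 3 , m≤m+n 8 3 , m≤m+n 8 0
quarter 4 _ = 1 , m≤m+n 6 2 , m≤m+n 8 6 , m≤m+n 8 1
quarter (suc (suc (suc (suc δ@(suc _))))) _ with r , l , u , v ← quarter δ (s≤s z≤n) =
  suc r , linear l 0 (arith₁ δ r) , linear u 8 (arith₂ δ r) , linear v 0 (arith₃ δ r)
  where
  arith₁ : ∀ δ r → 4 + δ + 2 + 4 * suc r + 0 ≡ 4 * suc (suc r) + (δ + 2)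
  arith₁ = solve-∀
  arith₂ : ∀ δ r → 4 * suc (suc r) + (3 * δ + 2) + 8 ≡ 3 * (4 + δ) + 2 + 4 * suc r
  arith₂ = solve-∀
  arith₃ : ∀ δ r → 4 * suc (suc r) + (δ + 5) + 0 ≡ 4 + δ + 5 + 4 * suc r
  arith₃ = solve-∀

-- From lower to lower and from upper to upper element one advances `2 * suc r` places in the chain,
-- so `w` and `f` are at least that. The `2 * k` elements above the second pair bound them from
-- above.
chain-re-pair : ∀ r {lo a d ps hi} → Chain lo (a ▹ d ∷ ps) hi → r < length ps →
  ∃[ w ] ∃[ e ] ∃[ f ] ∃[ qs ] ∃[ k ] (ps ↭ (a + w) ▹ e ∷ qs × length ps ≡ r + suc k × w + e ≡ d + f ×
    2 * suc r ≤ w × 2 * suc r ≤ f × lo + w + 2 + 2 * k ≤ hi × lo + f + 2 + 2 * k ≤ hi)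
chain-re-pair r {lo} {a} {d} {ps} {hi} (link lo≤a 1≤d chain) r<
  with c , e , qs , k , perm , length≡ , ≤c , c≤ ← chain-drop r chain r<
  with w , refl ← m≤n⇒∃[o]m+o≡n (≤-trans (m≤m+n a d) (≤-trans (n≤1+n _) (m+n≤o⇒m≤o (suc (a + d)) ≤c)))
  with f , f≡ ← m≤n⇒∃[o]m+o≡n (≤-trans (≤-trans (n≤1+n _) (m+n≤o⇒m≤o (suc (a + d)) ≤c)) (m≤m+n (a + w) e)) =
  w , e , f , qs , k , perm , length≡ ,
  +-cancelˡ-≡ a _ _ (trans (≡-sym (+-assoc a w e)) (trans (≡-sym f≡) (+-assoc a d f))) ,
  linear (≤c ⊕ 1≤d) 0 (arith₁ a d w r) ,
  linear (≤c ⊕ 1≤e ⊕ ≤-reflexive (≡-sym f≡)) 0 (arith₂ a d w e f r) ,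
  linear (lo≤a ⊕ 1≤e ⊕ c≤) 0 (arith₃ lo a w e k hi) ,
  linear (lo≤a ⊕ 1≤d ⊕ c≤ ⊕ ≤-reflexive f≡) 0 (arith₄ lo a d w e f k hi)
  where
  1≤e = All.head (All-resp-↭ perm (chain-positive chain))
  arith₁ : ∀ a d w r → 2 * suc r + (a + w + d) + 0 ≡ w + (suc (a + d) + 2 * r + 1)
  arith₁ = solve-∀
  arith₂ : ∀ a d w e f r → 2 * suc r + (a + w + e + (a + d + f)) + 0 ≡ f + (suc (a + d) + 2 * r + 1 + (a + w + e))
  arith₂ = solve-∀
  arith₃ : ∀ lo a w e k hi → lo + w + 2 + 2 * k + (a + e + hi) + 0 ≡ hi + (lo + 1 + (suc (a + w + e) + 2 * k))
  arith₃ = solve-∀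
  arith₄ : ∀ lo a d w e f k hi → lo + f + 2 + 2 * k + (a + d + hi + (a + w + e)) + 0 ≡
    hi + (lo + 1 + (suc (a + w + e) + 2 * k) + (a + d + f))
  arith₄ = solve-∀

-- `bs` lies on the longer side of the gap `g`, below or above it, and `cs` on the other. The
-- hypothesis on `hi′ + g` covers both positions: the interval of `bs`, the pair of difference `g`
-- and the elements of `cs` fit disjointly into `[1, hi)`.
dominant-block : ∀ {x g bs cs lo′ hi′ hi} → Chain lo′ bs hi′ → Positive cs → length cs ≤ length bs →
  9 ≤ suc (length bs + length cs) →
  hi′ + g + 2 + 2 * length cs ≤ hi + lo′ → hi + 2 ≤ 4 * suc (length bs + length cs) →
  3 + widths (x ▹ g ∷ bs ++ cs) ≤ 3 * suc (length bs + length cs) →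
  2 + widths (bs ++ cs) ≤ g → 2 ∣ widths (x ▹ g ∷ bs ++ cs) →
  Splits (elems (x ▹ g ∷ bs ++ cs)) 0 0
dominant-block ([] _) [] _ (s≤s ())
dominant-block ([] _) (_ ∷ _) ()
dominant-block {x} {g} {a ▹ d ∷ bs} {cs} {lo′} {hi′} {hi} chain@(link _ 1≤d _) positive shorter 9≤t room hi≤ total dominant even =
  go (m≤n⇒∃[o]m+o≡n g≥)
  where
  B = length bs
  C = length cs
  positive₀ = All.tail (chain-positive chain)

  g≥ : 3 + (B + C) ≤ g
  g≥ = linear (dominant ⊕ widths-≥ (All.++⁺ (chain-positive chain) positive) ⊕ ≤-reflexive (≡-sym (length-++ bs {cs}))) 0
    (arith g (widths (a ▹ d ∷ bs ++ cs)) B C (length (bs ++ cs)))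
    where
    arith : ∀ g W B C L → 3 + (B + C) + (g + W + L) + 0 ≡ g + (2 + W + suc L * 1 + (B + C))
    arith = solve-∀

  go : ∃[ δ ] 3 + (B + C) + δ ≡ g → Splits (elems (x ▹ g ∷ (a ▹ d ∷ bs) ++ cs)) 0 0
  go (δ , g≡) with r , δ≤ , ≤δ , ≤δ+5 ← quarter (suc δ) (s≤s z≤n) = finish (chain-re-pair r chain r<)
    where
    -- With `t = 2 + B + C` pairs, the room around the gap and `hi + 2 ≤ 4t` give `g ≤ 2t - 2`,
    -- hence `4 * suc r ≤ t + 3`. As `C ≤ suc B` and `9 ≤ t` imply `3 ≤ B`, this is at most `4 * B`.
    r< : r < B
    r< = *-cancelˡ-≤ 4 (linear
      (≤δ+5 ⊕ shorter ⊕ shorter ⊕ 9≤t ⊕ ≤-reflexive g≡ ⊕ chain-length chain ⊕ room ⊕ hi≤) 0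
      (arith g lo′ hi hi′ B C δ r))
      where
      arith : ∀ g lo′ hi hi′ B C δ r →
        4 * suc r + (suc δ + 5 + suc B + suc B + suc (suc B + C) + g + hi′ + (hi + lo′) + 4 * suc (suc B + C)) + 0 ≡
        4 * B + (4 * suc r + C + C + 9 + (3 + (B + C) + δ) + (lo′ + 2 * suc B) + (hi′ + g + 2 + 2 * C) + (hi + 2))
      arith = solve-∀

    finish : _ → Splits (elems (x ▹ g ∷ (a ▹ d ∷ bs) ++ cs)) 0 0
    finish (w , e , f , qs , k , perm , length≡ , w+e≡ , ≤w , ≤f , w≤ , f≤) =
      splits-↭ (elems-↭ (↭-sym perm′)) (dominant-splits g d w e f (suc r) (suc δ) (qs ++ cs) x a w+e≡
        (All.++⁺ positive′ positive) 1≤d 1≤e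
        (linear (9≤t ⊕ ≤-reflexive n≡) 4 (arith₁ B C n))
        (subst (λ s → 2 + s ≤ g) widths≡ dominant)
        (linear (total ⊕ *-monoʳ-≤ 3 (≤-reflexive n≡) ⊕ ≤-reflexive (cong (g +_) (≡-sym widths≡))) 0
          (arith₂ (g + (d + widths (bs ++ cs))) (g + (d + (e + widths (qs ++ cs)))) B C n))
        ≤w ≤f (upper w w≤) (upper f f≤)
        (trans (≡-sym g≡) (trans (cong (λ s → 3 + s + δ) n≡) (≡-sym (+-suc (3 + n) δ))))
        δ≤ ≤δ (subst (λ s → 2 ∣ g + s) widths≡ even))
      where
      n = length (qs ++ cs)
      1≤e = All.head (All-resp-↭ perm positive₀)
      positive′ = All.tail (All-resp-↭ perm positive₀)

      perm′ : x ▹ g ∷ (a ▹ d ∷ bs) ++ cs ↭ x ▹ g ∷ a ▹ d ∷ (a + w) ▹ e ∷ qs ++ cs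
      perm′ = prep _ (prep _ (++⁺ʳ cs perm))

      widths≡ : d + widths (bs ++ cs) ≡ d + (e + widths (qs ++ cs))
      widths≡ = cong (d +_) (widths-↭ (++⁺ʳ cs perm))

      n≡ : B + C ≡ suc n
      n≡ = trans (≡-sym (length-++ bs)) (↭-length (++⁺ʳ cs perm))

      arith₁ : ∀ B C n → 2 + (suc (suc B + C) + suc n) + 4 ≡ n + (9 + (B + C))
      arith₁ = solve-∀
      arith₂ : ∀ W W′ B C n → 3 + W′ + (3 * suc (suc B + C) + 3 * suc n + W) + 0 ≡ 3 * (3 + n) + (3 + W + 3 * (B + C) + W′)
      arith₂ = solve-∀

      upper : ∀ v → lo′ + v + 2 + 2 * k ≤ hi′ → v + g + 2 ≤ 2 * (3 + n) + 2 * suc r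
      upper v v≤ = linear (v≤ ⊕ room ⊕ hi≤ ⊕ *-monoʳ-≤ 2 (≤-reflexive length≡) ⊕ *-monoʳ-≤ 2 (≤-reflexive n≡)) 0
        (arith v g lo′ hi′ hi B C n k r)
        where
        arith : ∀ v g lo′ hi′ hi B C n k r →
          v + g + 2 + (hi′ + (hi + lo′) + 4 * suc (suc B + C) + 2 * (r + suc k) + 2 * suc n) + 0 ≡
          2 * (3 + n) + 2 * suc r + (lo′ + v + 2 + 2 * k + (hi′ + g + 2 + 2 * C) + (hi + 2) + 2 * B + 2 * (B + C))
        arith = solve-∀

dominant-or-moderate : ∀ ps → (∃[ ls ] ∃[ p ] ∃[ rs ] (ps ≡ ls ++ p ∷ rs × 2 + widths ps ≤ 2 * width p)) ⊎
  All (λ p → 2 * width p ≤ 1 + widths ps) ps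
dominant-or-moderate ps with any? (λ p → 2 + widths ps ≤? 2 * width p) ps
... | no ¬h = inj₂ (All.map (λ ≰ → s≤s⁻¹ (≰⇒> ≰)) (All.¬Any⇒All¬ ps ¬h))
... | yes h with p , p∈ps , h′ ← find h with ls , rs , eq ← ∈-∃++ p∈ps = inj₁ (ls , p , rs , eq , h′)

-- The last hypothesis says that `width p` exceeds the sum of all other differences by at least 2.
-- The longer of `ls` and `rs` supplies the pairs that exchange partners.
dominant-chain : ∀ {hi} ls {p rs} (let ps = ls ++ p ∷ rs) → Chain 1 ps hi → hi + 2 ≤ 4 * length ps →
  3 + widths ps ≤ 3 * length ps → 9 ≤ length ps → 2 ∣ widths ps → 2 + widths ps ≤ 2 * width p → Splits (elems ps) 0 0
dominant-chain {hi} ls {x ▹ g} {rs} chain hi≤ total 9≤ even dominant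
  with mid , left , link mid≤x 1≤g right ← chain-++ ls chain = go (≤-total (length rs) (length ls))
  where
  go : length rs ≤ length ls ⊎ length ls ≤ length rs → Splits (elems (ls ++ x ▹ g ∷ rs)) 0 0
  go (inj₁ rs≤ls) = splits-↭ (elems-↭ (↭-sym perm))
    (dominant-block left (chain-positive right) rs≤ls
      (subst (9 ≤_) length≡ 9≤)
      (linear (mid≤x ⊕ chain-length right) 0 (arith mid x g (length rs) hi))
      (subst (λ l → hi + 2 ≤ 4 * l) length≡ hi≤)
      (subst₂ (λ w l → 3 + w ≤ 3 * l) (widths-↭ perm) length≡ total)
      (linear (subst (λ w → 2 + w ≤ 2 * g) (widths-↭ perm) dominant) 0 (arith′ g (widths (ls ++ rs))))
      (subst (2 ∣_) (widths-↭ perm) even))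
    where
    perm = shift (x ▹ g) ls rs
    length≡ = trans (↭-length perm) (cong suc (length-++ ls))
    arith : ∀ mid x g C hi → mid + g + 2 + 2 * C + (x + hi) + 0 ≡ hi + 1 + (mid + (suc (x + g) + 2 * C))
    arith = solve-∀
    arith′ : ∀ g w → 2 + w + 2 * g + 0 ≡ g + (2 + (g + w))
    arith′ = solve-∀
  go (inj₂ ls≤rs) = splits-↭ (elems-↭ (↭-sym perm))
    (dominant-block right (chain-positive left) ls≤rs
      (subst (9 ≤_) length≡ 9≤)
      (linear (mid≤x ⊕ chain-length left) 0 (arith mid x g (length ls) hi))
      (subst (λ l → hi + 2 ≤ 4 * l) length≡ hi≤)
      (subst₂ (λ w l → 3 + w ≤ 3 * l) (widths-↭ perm) length≡ total)
      (linear (subst (λ w → 2 + w ≤ 2 * g) (widths-↭ perm) dominant) 0 (arith′ g (widths (rs ++ ls))))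
      (subst (2 ∣_) (widths-↭ perm) even))
    where
    perm = ↭-trans (shift (x ▹ g) ls rs) (prep _ (++-comm ls rs))
    length≡ = trans (↭-length perm) (cong suc (length-++ rs))
    arith : ∀ mid x g C hi → hi + g + 2 + 2 * C + (x + mid) + 0 ≡ hi + suc (x + g) + (mid + (1 + 2 * C))
    arith = solve-∀
    arith′ : ∀ g w → 2 + w + 2 * g + 0 ≡ g + (2 + (g + w))
    arith′ = solve-∀

chain-splits : ∀ {ps hi} → Chain 1 ps hi → hi + 2 ≤ 4 * length ps → 9 ≤ length ps → 2 ∣ widths ps → Splits (elems ps) 0 0
chain-splits {ps} {hi} chain hi≤ 9≤ even = go (unit-or-wide ps (chain-positive chain)) (dominant-or-moderate ps)
  where
  -- Successive pairs are at least 1 apart, so the differences and the number of pairs together fill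
  -- at most `hi - 1 ≤ 4 * length ps - 3`: the average difference is below 3.
  total : 3 + widths ps ≤ 3 * length ps
  total = linear (chain-widths chain ⊕ hi≤) 0 (arith (widths ps) (length ps) hi)
    where
    arith : ∀ w l hi → 3 + w + (hi + 4 * l) + 0 ≡ 3 * l + (1 + w + l + (hi + 2))
    arith = solve-∀

  go : (∃[ a ] ∃[ qs ] ps ↭ a ▹ 1 ∷ qs) ⊎ All (λ p → 2 ≤ width p) ps → _ → Splits (elems ps) 0 0
  go (inj₂ wide) _ with adjacent-or-long chain wide
  ... | inj₁ adjacent = adjacent-splits adjacent wide (≤-trans (m≤m+n 4 5) 9≤) total even
  ... | inj₂ long = ⊥-elim (1≰0 (linear (long ⊕ hi≤) 1 (arith (length ps) hi)))
    where
    arith : ∀ l hi → 1 + (suc hi + 4 * l) + 1 ≡ 0 + (1 + 4 * l + (hi + 2))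
    arith = solve-∀
  go _ (inj₁ (ls , p , rs , refl , dominant)) = dominant-chain ls chain hi≤ total 9≤ even dominant
  go (inj₁ (a , qs , perm)) (inj₂ moderate) = splits-↭ (elems-↭ (↭-sym perm)) (moderate-splits a
    (All.tail (All-resp-↭ perm (chain-positive chain)))
    (linear (subst₂ (λ w l → 3 + w ≤ 3 * l) (widths-↭ perm) (↭-length perm) total) 0 (arith (widths qs) (length qs)))
    (subst (λ w → All (λ p → 2 * width p ≤ 1 + w) qs) (widths-↭ perm) (All.tail (All-resp-↭ perm moderate)))
    (subst (2 ∣_) (widths-↭ perm) even))
    where
    arith : ∀ w l → suc w + 3 * suc l + 0 ≡ 3 * l + (3 + suc w)
    arith = solve-∀

ascending-chain : ∀ {lo hi xs} t → AllPairs _<_ xs → All (lo ≤_) xs → All (_< hi) xs → lo ≤ hi → length xs ≡ t + t →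
  ∃[ ps ] (elems ps ≡ xs × length ps ≡ t × Chain lo ps hi)
ascending-chain zero [] _ _ lo≤hi _ = [] , refl , refl , [] lo≤hi
ascending-chain (suc t) [] _ _ _ ()
ascending-chain (suc t) (_ ∷ []) _ _ _ eq with () ← trans eq (cong suc (+-suc t t))
ascending-chain {lo} {hi} (suc t) ((x<y ∷ _) ∷ y< ∷ asc) (lo≤x ∷ _) (_ ∷ y<hi ∷ xs<hi) _ eq
  with d , refl ← m≤n⇒∃[o]m+o≡n (<⇒≤ x<y)
  with ps , refl , refl , chain ← ascending-chain t asc y< xs<hi y<hi (suc-injective (trans (suc-injective eq) (+-suc t t))) =
  _ , refl , refl , link lo≤x (+-cancelˡ-< _ 0 d (≤-trans (s≤s (≤-reflexive (+-identityʳ _))) x<y)) chain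

ascending-splits : ∀ {hi xs} t → AllPairs _<_ xs → All (1 ≤_) xs → All (_< hi) xs → length xs ≡ t + t →
  hi + 2 ≤ 4 * t → 9 ≤ t → 2 ∣ sum xs → Splits xs 0 0
ascending-splits {hi} {[]} zero _ _ _ _ _ ()
ascending-splits {hi} {x ∷ _} t asc 1≤xs xs<hi length≡ hi≤ 9≤ even
  with ps , elems≡ , refl , chain ← ascending-chain t asc 1≤xs xs<hi (≤-trans (s≤s z≤n) (All.head xs<hi)) length≡ =
  subst (λ xs → Splits xs 0 0) elems≡
    (chain-splits chain hi≤ 9≤ (2∣widths ps (subst (λ xs → 2 ∣ sum xs) (≡-sym elems≡) even)))

-- Reduction to one vertex per odd degree class

odd : ℕ → Bool
odd c = c % 2 ≡ᵇ 1

odd-suc : ∀ c → odd (suc c) ≡ not (odd c)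
odd-suc 0             = refl
odd-suc 1             = refl
odd-suc (suc (suc c)) = odd-suc c

≡ᵇ-refl : ∀ n → (n ≡ᵇ n) ≡ true
≡ᵇ-refl zero    = refl
≡ᵇ-refl (suc n) = ≡ᵇ-refl n

≢⇒≡ᵇ-false : ∀ {m n} → m ≢ n → (m ≡ᵇ n) ≡ false
≢⇒≡ᵇ-false {m} {n} m≢n with m ≡ᵇ n in eq
... | false = refl
... | true  = ⊥-elim (m≢n (≡ᵇ⇒≡ m n (subst T (≡-sym eq) _)))

module _ {A : Set} where

  filterᵇ-cong : ∀ {p q : A → Bool} {xs} → All (λ x → p x ≡ q x) xs → filterᵇ p xs ≡ filterᵇ q xs
  filterᵇ-cong [] = refl
  filterᵇ-cong {p} {q} {x ∷ xs} (eq ∷ eqs) with p x | q x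
  filterᵇ-cong (refl ∷ eqs) | true  | _ = cong (_ ∷_) (filterᵇ-cong eqs)
  filterᵇ-cong (refl ∷ eqs) | false | _ = filterᵇ-cong eqs

  filterᵇ-toggle : ∀ {p q : A → Bool} {x xs} → Unique xs → x ∈ xs → (∀ y → x ≢ y → p y ≡ q y) →
    p x ≡ false → q x ≡ true → filterᵇ q xs ↭ x ∷ filterᵇ p xs
  filterᵇ-toggle {p} {q} {x} (x∉xs ∷ _) (here refl) agree px qx with p x | q x
  filterᵇ-toggle (x∉xs ∷ _) (here refl) agree refl refl | _ | _ =
    prep _ (↭-reflexive (≡-sym (filterᵇ-cong (All.map (agree _) x∉xs))))
  filterᵇ-toggle {p} {q} {xs = y ∷ _} (y∉xs ∷ unique) (there x∈xs) agree px qx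
    with p y | q y | agree y (λ x≡y → All.lookup y∉xs x∈xs (≡-sym x≡y))
  ... | true  | _ | refl = ↭-trans (prep y (filterᵇ-toggle unique x∈xs agree px qx)) (swap y _ ↭-refl)
  ... | false | _ | refl = filterᵇ-toggle unique x∈xs agree px qx

module _ {A : Set} (f : A → ℕ) where

  classSize : List A → ℕ → ℕ
  classSize vs i = length (filterᵇ (λ v → f v ≡ᵇ i) vs)

  classSize-hit : ∀ v vs → classSize (v ∷ vs) (f v) ≡ suc (classSize vs (f v))
  classSize-hit v vs rewrite ≡ᵇ-refl (f v) = refl

  classSize-miss : ∀ v vs i → f v ≢ i → classSize (v ∷ vs) i ≡ classSize vs i
  classSize-miss v vs i fv≢i rewrite ≢⇒≡ᵇ-false fv≢i = refl

  -- Each new vertex toggles the parity of its class. If the class becomes odd, its value joins the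
  -- unmatched ones; if it becomes even, the value pairs off with the waiting equal one, and the two
  -- go to opposite sides.
  odd-classes : ∀ {is} → Unique is → ∀ vs → All (λ v → f v ∈ is) vs →
    ∃[ xs ] (map f vs ↭ filterᵇ (λ i → odd (classSize vs i)) is ++ xs × Splits xs 0 0)
  odd-classes {is} _ [] [] = [] , ↭-reflexive (≡-sym (cong (_++ []) (none is))) , splits-[]
    where
    none : ∀ is → filterᵇ (λ _ → false) is ≡ []
    none []       = refl
    none (_ ∷ is) = none is
  odd-classes {is} unique (v ∷ vs) (fv∈is ∷ fvs∈is)
    with xs , perm , s ← odd-classes unique vs fvs∈is | odd (classSize vs (f v)) in eq
  ... | false = xs ,
    ↭-trans (prep (f v) perm) (++⁺ʳ xs (↭-sym (filterᵇ-toggle unique fv∈is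
      (λ i fv≢i → cong odd (≡-sym (classSize-miss v vs i fv≢i))) eq
      (trans (cong odd (classSize-hit v vs)) (trans (odd-suc (classSize vs (f v))) (cong not eq)))))) ,
    s
  ... | true = f v ∷ f v ∷ xs ,
    ↭-trans (prep (f v) (↭-trans perm (++⁺ʳ xs (filterᵇ-toggle unique fv∈is
        (λ i fv≢i → cong odd (classSize-miss v vs i fv≢i))
        (trans (cong odd (classSize-hit v vs)) (trans (odd-suc (classSize vs (f v))) (cong not eq))) eq))))
      (↭-sym (↭-trans (shift (f v) ys (f v ∷ xs)) (prep (f v) (shift (f v) ys xs)))) ,
    splits-∷∷ (f v) (f v) (splits-shift (≡-sym (+-identityʳ (f v))) s)
    where
    ys = filterᵇ (λ i → odd (classSize (v ∷ vs) i)) is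

-- Distances and edges in a graph of diameter 2

-- The helper behind dist is private to Defs; the placeholder below is solved by unification with it,
-- once with-abstraction has made its fuel and its starting point distinct variables.
mutual
  search : ∀ n → Graph n → ℕ → ℕ → Fin n → Fin n → ℕ
  search = _

  dist-search : ∀ f (G : Graph (suc f)) u v →
    dist G u v ≡ (if reach G 0 u v then 0 else search (suc f) G f 1 u v)
  dist-search f G u v with suc f | 1
  ... | n | k = refl

search-≥ : ∀ {n} (G : Graph n) f k {u v} → k + f ≤ n → k ≤ search n G f k u v
-- When the fuel runs out, the default `n` is returned, and the hypothesis keeps it at least `k`.
search-≥ G zero k k≤n = ≤-trans (≤-reflexive (≡-sym (+-identityʳ k))) k≤n
search-≥ G (suc f) k {u} {v} k+f≤n with reach G k u v
... | true  = ≤-refl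
... | false = ≤-trans (n≤1+n k) (search-≥ G f (suc k) (≤-trans (≤-reflexive (≡-sym (+-suc k f))) k+f≤n))

module _ {n : ℕ} (G : Graph n) where

  reach-zero : ∀ {u v} → u ≢ v → reach G 0 u v ≡ false
  reach-zero u≢v = ≢⇒≡ᵇ-false (u≢v ∘ toℕ-injective)

  reach-one : ∀ {u v} → u ≢ v → reach G 1 u v ≡ adj G u v
  reach-one {u} {v} u≢v rewrite reach-zero u≢v with adj G u v in uv
  ... | true = to T-≡ (any⁺ _ (lose (∈-allFin u) (from T-∧ (from T-≡ (≡ᵇ-refl (toℕ u)) , from T-≡ uv))))
  ... | false with any (λ w → reach G 0 u w ∧ adj G w v) (allFin n) in eq
  ...   | false = refl
  ...   | true with w , _ , h ← find (any⁻ (λ w → reach G 0 u w ∧ adj G w v) (allFin n) (from T-≡ eq))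
               with u≡w , wv ← to T-∧ h
               with refl ← toℕ-injective (≡ᵇ⇒≡ (toℕ u) (toℕ w) u≡w) = trans (≡-sym (to T-≡ wv)) uv

  isolated-reach : ∀ {u} → (∀ w → adj G u w ≡ false) → ∀ k {v} → T (reach G k u v) → u ≡ v
  isolated-reach _ zero r = toℕ-injective (≡ᵇ⇒≡ _ _ r)
  isolated-reach {u} isolated (suc k) {v} r with to T-∨ r
  ... | inj₁ r′ = isolated-reach isolated k r′
  ... | inj₂ a with w , _ , h ← find (any⁻ (λ w → reach G k u w ∧ adj G w v) (allFin n) a)
               with r′ , wv ← to T-∧ h
               with refl ← isolated-reach isolated k r′ = ⊥-elim (subst T (isolated v) wv)

-- On `3 + n` vertices the fuel suffices to unfold `dist` into these three conditionals. The rest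
-- `s` of the search starts at 3, so a distance at most 2 is decided before it.
first-reached : ∀ {b₀ b₁ b₂ b s} → b₀ ≡ false → b₁ ≡ b → 3 ≤ s →
  (let d = if b₀ then 0 else if b₁ then 1 else if b₂ then 2 else s) → d ≤ 2 →
  d ≡ (if b then 1 else 2) × (T b₁ ⊎ T b₂)
first-reached {b₁ = true}               refl refl _   _   = refl , inj₁ _
first-reached {b₁ = false} {b₂ = true}  refl refl _   _   = refl , inj₂ _
first-reached {b₁ = false} {b₂ = false} refl refl 3≤s s≤2 = ⊥-elim (<⇒≱ 3≤s s≤2)

module _ {n : ℕ} (G : Graph (3 + n)) (diameter : ∀ u v → dist G u v ≤ 2) where

  dist-reach : ∀ {u v} → u ≢ v → dist G u v ≡ (if adj G u v then 1 else 2) × (T (reach G 1 u v) ⊎ T (reach G 2 u v))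
  dist-reach {u} {v} u≢v = first-reached (reach-zero G u≢v) (reach-one G u≢v) (search-≥ G n 3 ≤-refl) (diameter u v)

  dist-adj : ∀ {u v} → u ≢ v → dist G u v ≡ (if adj G u v then 1 else 2)
  dist-adj = proj₁ ∘ dist-reach

  -- An isolated vertex reaches only itself, yet within two steps it would have to reach two
  -- distinct vertices.
  not-isolated : ∀ u → ¬ (∀ w → adj G u w ≡ false)
  not-isolated u isolated = all-equal (reached Fin.zero) (reached (Fin.suc Fin.zero))
    where
    reached : ∀ v → u ≡ v
    reached v with u Fin.≟ v
    ... | yes u≡v = u≡v
    ... | no u≢v with proj₂ (dist-reach u≢v)
    ...   | inj₁ r = isolated-reach G isolated 1 r
    ...   | inj₂ r = isolated-reach G isolated 2 r

    all-equal : u ≡ Fin.zero → u ≢ Fin.suc Fin.zero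
    all-equal refl ()

  -- Excluding degree 0 gives the lower end 1 of the interval in the density count.
  degree-positive : ∀ v → 1 ≤ degree G v
  degree-positive v with degree G v in eq
  ... | suc _ = s≤s z≤n
  ... | zero  = ⊥-elim (not-isolated v isolated)
    where
    isolated : ∀ w → adj G v w ≡ false
    isolated w with adj G v w in vw
    ... | false = refl
    ... | true with () ← subst (λ k → Fin k) eq
                 (Any.index (∈-filter⁺ (T? ∘ adj G v) (∈-allFin w) (from T-≡ vw)))

degree-< : ∀ {n} (G : Graph n) v → degree G v < n
degree-< {n} G v = subst (degree G v <_) (length-tabulate (λ i → i))
  (filter-notAll (T? ∘ adj G v) (allFin n) (lose (∈-allFin v) (subst T (irrefl G v))))

-- Degree sums, edge counts and distance multisets

ind : Bool → ℕ
ind b = if b then 1 else 0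

module _ {A : Set} where

  Σ-cong : ∀ {f g : A → ℕ} → (∀ x → f x ≡ g x) → ∀ xs → sum (map f xs) ≡ sum (map g xs)
  Σ-cong f≗g xs = cong sum (map-cong f≗g xs)

  Σ-+ : ∀ (f g : A → ℕ) xs → sum (map (λ x → f x + g x) xs) ≡ sum (map f xs) + sum (map g xs)
  Σ-+ f g [] = refl
  Σ-+ f g (x ∷ xs) = trans (cong (f x + g x +_) (Σ-+ f g xs)) (rearrange (f x) (g x) _ _)
    where
    rearrange : ∀ a b c d → (a + b) + (c + d) ≡ (a + c) + (b + d)
    rearrange = solve-∀

  Σ-++ : ∀ (f : A → ℕ) xs ys → sum (map f (xs ++ ys)) ≡ sum (map f xs) + sum (map f ys)
  Σ-++ f xs ys = trans (cong sum (map-++ f xs ys)) (sum-++ (map f xs) (map f ys))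

  length-filterᵇ : ∀ (p : A → Bool) xs → length (filterᵇ p xs) ≡ sum (map (ind ∘ p) xs)
  length-filterᵇ p [] = refl
  length-filterᵇ p (x ∷ xs) with p x
  ... | true  = cong suc (length-filterᵇ p xs)
  ... | false = length-filterᵇ p xs

module _ {n : ℕ} (G : Graph n) where
  private
    A : Fin n → Fin n → ℕ
    A u v = ind (adj G u v)

  edges : List (Fin n) → ℕ
  edges S = sum (map (uncurry A) (pairs S))

  degreeInto : List (Fin n) → Fin n → ℕ
  degreeInto S v = sum (map (A v) S)

  A-sym : ∀ u v → A u v ≡ A v u
  A-sym u v = cong ind (sym G u v)

  -- The handshake lemma for the subgraph induced on `S`.
  Σ-degreeInto-self : ∀ S → sum (map (degreeInto S) S) ≡ edges S + edges S
  Σ-degreeInto-self [] = refl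
  Σ-degreeInto-self (x ∷ S) = begin
    A x x + s + sum (map (λ v → A v x + degreeInto S v) S)
      ≡⟨ cong₂ (λ a b → ind a + s + b) (irrefl G x) (Σ-+ (λ v → A v x) (degreeInto S) S) ⟩
    s + (sum (map (λ v → A v x) S) + sum (map (degreeInto S) S))
      ≡⟨ cong₂ (λ a b → s + (a + b)) (Σ-cong (λ v → A-sym v x) S) (Σ-degreeInto-self S) ⟩
    s + (s + (edges S + edges S))      ≡⟨ rearrange s (edges S) ⟩
    (s + edges S) + (s + edges S)      ≡⟨ cong₂ _+_ unfold unfold ⟨
    edges (x ∷ S) + edges (x ∷ S)      ∎
    where
    open ≡-Reasoning
    s = degreeInto S x
    rearrange : ∀ s e → s + (s + (e + e)) ≡ (s + e) + (s + e)
    rearrange = solve-∀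
    unfold : edges (x ∷ S) ≡ s + edges S
    unfold = trans (Σ-++ (uncurry A) (map (x ,_) S) (pairs S)) (cong (λ ys → sum ys + edges S) (≡-sym (map-∘ S)))

  Σ-degreeInto-comm : ∀ S T → sum (map (degreeInto T) S) ≡ sum (map (degreeInto S) T)
  Σ-degreeInto-comm [] T = ≡-sym (zeros T)
    where
    zeros : ∀ T → sum (map (degreeInto []) T) ≡ 0
    zeros []      = refl
    zeros (_ ∷ T) = zeros T
  Σ-degreeInto-comm (x ∷ S) T = begin
    degreeInto T x + sum (map (degreeInto T) S)                   ≡⟨ cong₂ _+_ (Σ-cong (A-sym x) T) (Σ-degreeInto-comm S T) ⟩
    sum (map (λ v → A v x) T) + sum (map (degreeInto S) T)        ≡⟨ Σ-+ (λ v → A v x) (degreeInto S) T ⟨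
    sum (map (degreeInto (x ∷ S)) T)                              ∎
    where open ≡-Reasoning

  degree-Σ : ∀ v → degree G v ≡ degreeInto (allFin n) v
  degree-Σ v = length-filterᵇ (adj G v) (allFin n)

  2∣Σ-degree : 2 ∣ sum (map (degree G) (allFin n))
  2∣Σ-degree = subst (2 ∣_) (≡-sym (trans (Σ-cong degree-Σ (allFin n)) (Σ-degreeInto-self (allFin n)))) (2∣+ (edges (allFin n)))

  module _ {S T : List (Fin n)} (partition : allFin n ↭ S ++ T) where

    Σ-degree-part : ∀ U → sum (map (degree G) U) ≡ sum (map (degreeInto S) U) + sum (map (degreeInto T) U)
    Σ-degree-part U = trans
      (Σ-cong (λ v → trans (degree-Σ v) (trans (sum-↭ (map⁺ (A v) partition)) (Σ-++ (A v) S T))) U)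
      (Σ-+ (degreeInto S) (degreeInto T) U)

    -- The number `X` of edges between `S` and `T` enters both degree sums and cancels.
    equal-degrees⇒equal-edges : sum (map (degree G) S) ≡ sum (map (degree G) T) → edges S ≡ edges T
    equal-degrees⇒equal-edges eq = *-cancelˡ-≡ _ _ 2 (+-cancelʳ-≡ X _ _ (begin
      2 * edges S + X                                               ≡⟨ cong (_+ X) (double (edges S)) ⟩
      edges S + edges S + X                                         ≡⟨ cong (_+ X) (Σ-degreeInto-self S) ⟨
      sum (map (degreeInto S) S) + X                                ≡⟨ Σ-degree-part S ⟨
      sum (map (degree G) S)                                        ≡⟨ eq ⟩
      sum (map (degree G) T)                                        ≡⟨ Σ-degree-part T ⟩
      sum (map (degreeInto S) T) + sum (map (degreeInto T) T)       ≡⟨ cong₂ _+_ (Σ-degreeInto-comm T S) (Σ-degreeInto-self T) ⟩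
      X + (edges T + edges T)                                       ≡⟨ +-comm X _ ⟩
      edges T + edges T + X                                         ≡⟨ cong (_+ X) (double (edges T)) ⟨
      2 * edges T + X                                               ∎))
      where
      open ≡-Reasoning
      X = sum (map (degreeInto T) S)
      double : ∀ e → 2 * e ≡ e + e
      double = solve-∀

-- Both lists are brought to the normal form of all `true` followed by all `false`.
Bool-↭ : ∀ bs cs → length bs ≡ length cs → sum (map ind bs) ≡ sum (map ind cs) → bs ↭ cs
Bool-↭ bs cs length≡ sum≡ = ↭-trans (normal bs) (↭-trans
  (↭-reflexive (cong₂ (λ t f → replicate t true ++ replicate f false) sum≡ falses≡))
  (↭-sym (normal cs)))
  where
  trues falses : List Bool → ℕ
  trues bs  = sum (map ind bs)
  falses bs = sum (map (ind ∘ not) bs)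

  count : ∀ bs → trues bs + falses bs ≡ length bs
  count [] = refl
  count (true ∷ bs) = cong suc (count bs)
  count (false ∷ bs) = trans (+-suc (trues bs) _) (cong suc (count bs))

  falses≡ : falses bs ≡ falses cs
  falses≡ = +-cancelˡ-≡ (trues bs) _ _ (trans (count bs)
    (trans length≡ (trans (≡-sym (count cs)) (cong (_+ falses cs) (≡-sym sum≡)))))

  normal : ∀ bs → bs ↭ replicate (trues bs) true ++ replicate (falses bs) false
  normal [] = ↭-refl
  normal (true ∷ bs) = prep true (normal bs)
  normal (false ∷ bs) = ↭-trans (prep false (normal bs)) (↭-sym (shift false (replicate (trues bs) true) _))

length-pairs : ∀ {A : Set} (xs ys : List A) → length xs ≡ length ys → length (pairs xs) ≡ length (pairs ys)
length-pairs [] [] _ = refl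
length-pairs (x ∷ xs) (y ∷ ys) eq = begin
  length (map (x ,_) xs ++ pairs xs)          ≡⟨ length-++ (map (x ,_) xs) ⟩
  length (map (x ,_) xs) + length (pairs xs)  ≡⟨ cong₂ _+_ heads (length-pairs xs ys (suc-injective eq)) ⟩
  length (map (y ,_) ys) + length (pairs ys)  ≡⟨ length-++ (map (y ,_) ys) ⟨
  length (map (y ,_) ys ++ pairs ys)          ∎
  where
  open ≡-Reasoning
  heads = trans (length-map (x ,_) xs) (trans (suc-injective eq) (≡-sym (length-map (y ,_) ys)))

pairs-≢ : ∀ {A : Set} {xs : List A} → Unique xs → All (uncurry _≢_) (pairs xs)
pairs-≢ [] = []
pairs-≢ (x∉xs ∷ unique) = All.++⁺ (All.map⁺ x∉xs) (pairs-≢ unique)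

-- Distances between distinct vertices are 1 or 2 according to adjacency, so the distance multiset
-- is the image of a list of Booleans whose number of `true` entries is the edge count.
homometric : ∀ {n} (G : Graph (3 + n)) → (∀ u v → dist G u v ≤ 2) → ∀ {S T} → Unique S → Unique T →
  length S ≡ length T → edges G S ≡ edges G T → D G S ↭ D G T
homometric G diameter {S} {T} uniqueS uniqueT length≡ edges≡ = ↭-trans (↭-reflexive (distances uniqueS))
  (↭-trans (map⁺ (λ b → if b then 1 else 2) (Bool-↭ (adjacencies S) (adjacencies T)
      (trans (length-map _ (pairs S)) (trans (length-pairs S T length≡) (≡-sym (length-map _ (pairs T)))))
      (trans (cong sum (≡-sym (map-∘ (pairs S)))) (trans edges≡ (cong sum (map-∘ (pairs T)))))))
    (↭-reflexive (≡-sym (distances uniqueT))))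
  where
  adjacencies : List _ → List Bool
  adjacencies = map (uncurry (adj G)) ∘ pairs

  distances : ∀ {S} → Unique S → D G S ≡ map (λ b → if b then 1 else 2) (adjacencies S)
  distances {S} unique = trans (map-cong-local (All.map (dist-adj G diameter) (pairs-≢ unique))) (map-∘ (pairs S))

-- Assembling the homometric halves

Unique-length : ∀ {n} {xs : List (Fin n)} → Unique xs → length xs ≤ n
Unique-length unique = injective⇒≤ (lookup-injective unique)
  where
  lookup-injective : ∀ {A : Set} {xs : List A} → Unique xs → ∀ {i j} → lookup xs i ≡ lookup xs j → i ≡ j
  lookup-injective (_ ∷ _) {Fin.zero} {Fin.zero} _ = refl
  lookup-injective (x∉xs ∷ _) {Fin.zero} {Fin.suc j} eq = ⊥-elim (All.lookup x∉xs (∈-lookup j) eq)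
  lookup-injective (x∉xs ∷ _) {Fin.suc i} {Fin.zero} eq = ⊥-elim (All.lookup x∉xs (∈-lookup i) (≡-sym eq))
  lookup-injective (_ ∷ unique) {Fin.suc i} {Fin.suc j} eq = cong Fin.suc (lookup-injective unique eq)

2∣cancelʳ : ∀ m {n} → 2 ∣ n + m → 2 ∣ m → 2 ∣ n
2∣cancelʳ m {n} 2∣n+m = ∣m+n∣m⇒∣n (subst (2 ∣_) (+-comm n m) 2∣n+m)

splits-even : ∀ {xs} → Splits xs 0 0 → 2 ∣ length xs × 2 ∣ sum xs
splits-even {xs} (ys , zs , perm , length≡ , sum≡) =
  subst (2 ∣_) (trans (cong (length ys +_) length≡) (≡-sym (trans (↭-length perm) (length-++ ys)))) (2∣+ (length ys)) ,
  subst (2 ∣_) (trans (cong (sum ys +_) sum≡′) (≡-sym (trans (sum-↭ perm) (sum-++ ys zs)))) (2∣+ (sum ys))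
  where
  sum≡′ = +-cancelʳ-≡ 0 (sum ys) (sum zs) sum≡

map-++⁻ : ∀ {A B : Set} {f : A → B} ys {zs} ws → ys ++ zs ≡ map f ws →
  ∃[ us ] ∃[ vs ] (ws ≡ us ++ vs × ys ≡ map f us × zs ≡ map f vs)
map-++⁻ [] ws eq = [] , ws , refl , refl , eq
map-++⁻ (y ∷ ys) (w ∷ ws) eq with refl , eq′ ← ∷-injective eq
  with us , vs , refl , refl , refl ← map-++⁻ ys ws eq′ = w ∷ us , vs , refl , refl , refl

Unique-++⁻ : ∀ {A : Set} (xs {ys} : List A) → Unique (xs ++ ys) → Unique xs × Unique ys × (∀ x → x ∈ xs → x ∉ ys)
Unique-++⁻ [] unique = [] , unique , λ _ ()
Unique-++⁻ (x ∷ xs) (x∉ ∷ unique) with uniqueˡ , uniqueʳ , disjoint ← Unique-++⁻ xs unique =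
  All.++⁻ˡ xs x∉ ∷ uniqueˡ , uniqueʳ , λ where
    _ (here refl)  x∈ys → All.lookup x∉ (∈-++⁺ʳ xs x∈ys) refl
    y (there y∈xs) y∈ys → disjoint y y∈xs y∈ys

module _ {n : ℕ} (m : ℕ) (3+n≡2m : 3 + n ≡ 2 * m) (90≤2m : 90 ≤ 2 * m)
         (G : Graph (3 + n)) (diameter : ∀ u v → dist G u v ≤ 2) where
  private
    V = allFin (3 + n)
    degrees = map (degree G) V
    classes = λ i → odd (classSize (degree G) V i)
    odds = filterᵇ classes (upTo (3 + n))

  length-V : length V ≡ 2 * m
  length-V = trans (length-tabulate id) 3+n≡2m

  -- Both parities come from the whole graph: the number of vertices is even, the degree sum is even
  -- by the handshake lemma, and `xs`, being split, has even length and even sum.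
  odds-split : m < length odds → ∀ {xs} → degrees ↭ odds ++ xs → Splits xs 0 0 → Splits odds 0 0
  odds-split m<odds {xs} perm s with splits-even s
  ... | 2∣length , 2∣sum with 2∣cancelʳ (length xs) {length odds} (subst (2 ∣_) length≡ (m∣m*n m)) 2∣length
    where
    length≡ = trans (≡-sym (trans (length-map _ V) length-V)) (trans (↭-length perm) (length-++ odds))
  ...   | divides t odds≡ = ascending-splits t
    (AllPairs.filter⁺ (T? ∘ classes) (AllPairs.applyUpTo⁺₁ id (3 + n) (λ i<j _ → i<j)))
    (All.++⁻ˡ odds (All-resp-↭ perm (All.map⁺ (All.universal (degree-positive G diameter) V))))
    (All.++⁻ˡ odds (All-resp-↭ perm (All.map⁺ (All.universal (degree-< G) V))))
    (trans odds≡ (double t))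
    -- From `m < 2t` follows `2 * m + 2 ≤ 4 * t`. This is the density bound for degrees below
    -- `3 + n = 2 * m`, and with `90 ≤ 2 * m` it yields `9 ≤ t`.
    (linear (m<2t ⊕ m<2t ⊕ ≤-reflexive 3+n≡2m) 0 (arith₁ (3 + n) m t))
    (*-cancelˡ-≤ 4 (linear (m<2t ⊕ m<2t ⊕ 90≤2m) 56 (arith₂ m t)))
    (2∣cancelʳ (sum xs) (subst (2 ∣_) (trans (sum-↭ perm) (sum-++ odds xs)) (2∣Σ-degree G)) 2∣sum)
    where
    m<2t = subst (m <_) odds≡ m<odds
    double : ∀ t → t * 2 ≡ t + t
    double = solve-∀
    arith₁ : ∀ N m t → N + 2 + (t * 2 + t * 2 + 2 * m) + 0 ≡ 4 * t + (suc m + suc m + N)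
    arith₁ = solve-∀
    arith₂ : ∀ m t → 4 * 9 + (t * 2 + t * 2 + 2 * m) + 56 ≡ 4 * t + (suc m + suc m + 90)
    arith₂ = solve-∀

  degrees-split : m < numOddClasses G ⊎ AllClassesEven G → Splits degrees 0 0
  degrees-split condition with xs , perm , s ← odd-classes (degree G) (Unique.upTo⁺ (3 + n)) V
                                 (All.universal (λ v → ∈-upTo⁺ (degree-< G v)) V) =
    splits-↭ (↭-sym perm) (splits-++ (odds-split′ condition) s)
    where
    odds-split′ : m < numOddClasses G ⊎ AllClassesEven G → Splits odds 0 0
    odds-split′ (inj₁ m<odds) = odds-split m<odds perm s
    odds-split′ (inj₂ even) = subst (λ xs → Splits xs 0 0) (≡-sym (filter-none (T? ∘ classes)
      (All.universal (λ i → subst (λ r → T (r ≡ᵇ 1)) (even i)) (upTo (3 + n))))) splits-[]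

  -- A split of the degrees, which are only numbers, is lifted along `degree G` to a partition of
  -- the vertices by `↭-map-inv`.
  homometric-halves : Splits degrees 0 0 → HomometricPairOfSize G m
  homometric-halves (ys , zs , perm , length≡ , sum≡)
    with ws , eq , V↭ws ← ↭-map-inv (degree G) {V} perm
    with S , T , refl , refl , refl ← map-++⁻ ys ws eq
    with uniqueS , uniqueT , disjoint ← Unique-++⁻ S (Permutationₛ.Unique-resp-↭ (setoid _) (↭⇒↭ₛ V↭ws) (Unique.allFin⁺ (3 + n))) =
    S , T , uniqueS , uniqueT , lengthS , trans (≡-sym lengthS≡T) lengthS , disjoint ,
    homometric G diameter uniqueS uniqueT lengthS≡T
      (equal-degrees⇒equal-edges G {S} {T} V↭ws (+-cancelʳ-≡ 0 _ _ sum≡))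
    where
    lengthS≡T : length S ≡ length T
    lengthS≡T = trans (≡-sym (length-map _ S)) (trans length≡ (length-map _ T))
    lengthS : length S ≡ m
    lengthS = *-cancelˡ-≡ _ _ 2 (trans (cong (length S +_) (trans (+-identityʳ _) lengthS≡T))
      (trans (≡-sym (length-++ S)) (trans (≡-sym (↭-length V↭ws)) length-V)))

homometric-≤ : ∀ {n} m (G : Graph n) → n ≡ 2 * m → ∀ k → HomometricPairOfSize G k → k ≤ m
homometric-≤ m G n≡2m _ (S , T , uniqueS , uniqueT , refl , length≡ , disjoint , _) = *-cancelˡ-≤ 2
  (subst₂ _≤_ (trans (length-++ S) (cong (length S +_) (trans length≡ (≡-sym (+-identityʳ _))))) n≡2m
    (Unique-length (Unique.++⁺ uniqueS uniqueT (λ (x∈S , x∈T) → disjoint _ x∈S x∈T))))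

-- The number of vertices is kept a variable, so that matching on `3 ≤ n` exposes the form `3 + n`
-- on which `dist` unfolds; `2 * m` does not have this form.
theorem8′ : ∀ {n} m → n ≡ 2 * m → 90 ≤ 2 * m → (G : Graph n) → HasDiameter2 G →
  m < numOddClasses G ⊎ AllClassesEven G → hEquals G m
theorem8′ {n} m n≡2m 90≤2m G = go n≡2m (subst (3 ≤_) (≡-sym n≡2m) (≤-trans (m≤m+n 3 87) 90≤2m)) G
  where
  go : ∀ {n} → n ≡ 2 * m → 3 ≤ n → (G : Graph n) → HasDiameter2 G → m < numOddClasses G ⊎ AllClassesEven G → hEquals G m
  go n≡2m (s≤s (s≤s (s≤s _))) G (diameter , _) condition =
    homometric-halves m n≡2m 90≤2m G diameter (degrees-split m n≡2m 90≤2m G diameter condition) ,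
    homometric-≤ m G n≡2m

theorem8 : (m : ℕ) → 90 ≤ 2 * m → (G : Graph (2 * m)) → HasDiameter2 G →
    (m < numOddClasses G ⊎ AllClassesEven G) → hEquals G m
theorem8 m = theorem8′ m refl
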